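{- There is an algorithm that, given a finite simple graph $G=(V,E_{\mathrm G}\cup E_{\mathrm B}\cup E_{\mathrm W})$ with $n=|V|$ vertices whose edge set is partitioned into gray edges $E_{\mathrm G}$, black edges $E_{\mathrm B}$ and white edges $E_{\mathrm W}$, and an active player in $\{\mathrm B,\mathrm W\}$, determines the winner of Colored Arc Kayles on $G$ starting from the active player's turn in time $O^*(2^n)$.
   Context: Colored Arc Kayles is played by two players B (black) and W (white) on a finite undirected graph $G=(V,E_{\mathrm G}\cup E_{\mathrm B}\cup E_{\mathrm W})$, where $E_{\mathrm G},E_{\mathrm B},E_{\mathrm W}$ are mutually disjoint. The players move alternately, starting with the active player. On a turn, player B must choose an edge in $E_{\mathrm G}\cup E_{\mathrm B}$ and player W must choose an edge in $E_{\mathrm G}\cup E_{\mathrm W}$ of the current graph. When an edge $e=\{u,v\}$ is chosen, $e$ and all edges sharing an endpoint with $e$ are removed (equivalently, the play continues on $G-u-v$), and the other player moves next. A player who has no edge to choose on their turn loses. The winner is the player having a winning strategy. The notation $O^*(\cdot)$ suppresses factors polynomial in the input size. -}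

module Defs where

open import Data.Bool using (Bool; true; false; _∨_; if_then_else_)
open import Data.Bool.Properties using (∨-comm)
open import Data.Fin using (Fin; _≟_)
open import Data.Maybe using (Maybe; just; nothing)
open import Data.Nat using (ℕ; suc; _+_)
open import Data.Product using (∃-syntax; _×_)
open import Data.Vec using (Vec; []; _∷_; lookup; tabulate; foldr′)
open import Relation.Nullary using (does)
open import Relation.Binary.PropositionalEquality using (_≡_; refl; cong)

data Player : Set where
  B W : Player

opponent : Player → Player
opponent B = W
opponent W = B

data Colour : Set where
  gray black white : Colour

-- The edge set and its partition in one map: `colour u v` is `nothing` when u
-- and v are not adjacent.
record ColoredGraph (n : ℕ) : Set where
  field
    colour    : Fin n → Fin n → Maybe Colour
    symmetric : ∀ u v → colour u v ≡ colour v u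
    loopless  : ∀ u → colour u u ≡ nothing

open ColoredGraph public

isEndpoint : ∀ {n} → Fin n → Fin n → Fin n → Bool
isEndpoint u v x = does (x ≟ u) ∨ does (x ≟ v)

-- Deletes {u,v} and every edge sharing an endpoint with it.  The vertices u and
-- v stay, isolated, which does not affect the available moves.
removeEdge : ∀ {n} → ColoredGraph n → Fin n → Fin n → ColoredGraph n
removeEdge G u v .colour x y =
  if isEndpoint u v x ∨ isEndpoint u v y then nothing else colour G x y
removeEdge G u v .symmetric x y
  rewrite ∨-comm (isEndpoint u v x) (isEndpoint u v y)
  = cong (if isEndpoint u v y ∨ isEndpoint u v x then nothing else_) (symmetric G x y)
removeEdge G u v .loopless x with isEndpoint u v x ∨ isEndpoint u v x
... | true  = refl
... | false = loopless G x

data MayChoose : Player → Colour → Set where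
  gray  : ∀ {p} → MayChoose p gray
  black : MayChoose B black
  white : MayChoose W white

LegalMove : ∀ {n} → Player → ColoredGraph n → Fin n → Fin n → Set
LegalMove p G u v = ∃[ c ] (colour G u v ≡ just c × MayChoose p c)

-- Winning strategies of player p as trees: a node of `ToMove` is p's choice, a
-- node of `ToReply` has one branch for every choice of the opponent.  Being
-- inductive, every play following the tree ends, and it can end only at a
-- `ToReply` node without branches, where the opponent is to move and is stuck.
mutual
  data ToMove {n} (p : Player) (G : ColoredGraph n) : Set where
    move : ∀ u v → LegalMove p G u v →
           ToReply p (removeEdge G u v) → ToMove p G

  data ToReply {n} (p : Player) (G : ColoredGraph n) : Set where
    reply : (∀ u v → LegalMove (opponent p) G u v →
             ToMove p (removeEdge G u v)) → ToReply p G

-- `WinningStrategy p active G`: for player p, when `active` moves first on G.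
WinningStrategy : ∀ {n} → Player → Player → ColoredGraph n → Set
WinningStrategy B B = ToMove B
WinningStrategy B W = ToReply B
WinningStrategy W B = ToReply W
WinningStrategy W W = ToMove W

-- The model of computation: a first-order, call-by-value functional language
-- over binary trees, in the style of N. D. Jones' language F ("Computability and
-- Complexity: From a Programming Perspective").
infixr 5 _∙_

data Tree : Set where
  nil : Tree
  _∙_ : Tree → Tree → Tree

size : Tree → ℕ
size nil     = 1
size (s ∙ t) = suc (size s + size t)

-- `Exp m k`: expressions with k variables in scope (de Bruijn indices) that may
-- call m mutually recursive unary functions.
data Exp (m : ℕ) : ℕ → Set where
  var    : ∀ {k} → Fin k → Exp m k
  nil    : ∀ {k} → Exp m k
  cons   : ∀ {k} → Exp m k → Exp m k → Exp m k
  letin  : ∀ {k} → Exp m k → Exp m (suc k) → Exp m k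
  match  : ∀ {k} → Exp m k → Exp m k → Exp m (suc (suc k)) → Exp m k
  call   : ∀ {k} → Fin m → Exp m k → Exp m k

record Program : Set where
  field
    functions : ℕ
    bodies : Vec (Exp functions 1) functions
    main   : Exp functions 1

-- `Eval fs ρ e v t`: in environment ρ, e evaluates to v in t steps.  Each rule
-- costs one step and does a bounded number of pointer operations (trees are
-- never copied, compared or traversed by a single rule), so t is, up to a
-- constant factor, the running time on a pointer machine or a word RAM.
data Eval {m : ℕ} (fs : Vec (Exp m 1) m) :
          ∀ {k} → Vec Tree k → Exp m k → Tree → ℕ → Set where
  var : ∀ {k} {ρ : Vec Tree k} i → Eval fs ρ (var i) (lookup ρ i) 1
  nil : ∀ {k} {ρ : Vec Tree k} → Eval fs ρ nil nil 1
  cons : ∀ {k} {ρ : Vec Tree k} {e₁ e₂ v₁ v₂ t₁ t₂} →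
         Eval fs ρ e₁ v₁ t₁ → Eval fs ρ e₂ v₂ t₂ →
         Eval fs ρ (cons e₁ e₂) (v₁ ∙ v₂) (suc (t₁ + t₂))
  letin : ∀ {k} {ρ : Vec Tree k} {e₁ e₂ v₁ v₂ t₁ t₂} →
          Eval fs ρ e₁ v₁ t₁ → Eval fs (v₁ ∷ ρ) e₂ v₂ t₂ →
          Eval fs ρ (letin e₁ e₂) v₂ (suc (t₁ + t₂))
  match-nil : ∀ {k} {ρ : Vec Tree k} {e e₁ e₂ v t₁ t₂} →
              Eval fs ρ e nil t₁ → Eval fs ρ e₁ v t₂ →
              Eval fs ρ (match e e₁ e₂) v (suc (t₁ + t₂))
  match-cons : ∀ {k} {ρ : Vec Tree k} {e e₁ e₂ v₁ v₂ v t₁ t₂} →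
               Eval fs ρ e (v₁ ∙ v₂) t₁ → Eval fs (v₁ ∷ v₂ ∷ ρ) e₂ v t₂ →
               Eval fs ρ (match e e₁ e₂) v (suc (t₁ + t₂))
  call : ∀ {k} {ρ : Vec Tree k} {f e v w t₁ t₂} →
         Eval fs ρ e v t₁ → Eval fs (v ∷ []) (lookup fs f) w t₂ →
         Eval fs ρ (call f e) w (suc (t₁ + t₂))

_on_returns_in-time_ : Program → Tree → Tree → ℕ → Set
P on input returns output in-time t =
  Eval (Program.bodies P) (input ∷ []) (Program.main P) output t

encodePlayer : Player → Tree
encodePlayer B = nil
encodePlayer W = nil ∙ nil

encodeEntry : Maybe Colour → Tree
encodeEntry nothing      = nil
encodeEntry (just gray)  = nil ∙ nil
encodeEntry (just black) = (nil ∙ nil) ∙ nil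
encodeEntry (just white) = nil ∙ (nil ∙ nil)

encodeVec : ∀ {n} → Vec Tree n → Tree
encodeVec = foldr′ _∙_ nil

encodeGraph : ∀ {n} → ColoredGraph n → Tree
encodeGraph G =
  encodeVec (tabulate λ u → encodeVec (tabulate λ v → encodeEntry (colour G u v)))

encodeInput : ∀ {n} → ColoredGraph n → Player → Tree
encodeInput G active = encodePlayer active ∙ encodeGraph G

module Submission where

-- For a set S of surviving vertices let X_k,p(S) say that player p, to move on
-- G[S], wins when whoever is to move after k moves is declared the loser.  Every
-- move kills two vertices, so X_n,p of the full set decides the game.  The X_k,p
-- are stored as binary trees of depth n, branching on whether a vertex survives,
-- and X_{k+1,p} is computed from X_k,q (q the opponent) for all S at once, by
-- recursion on the first vertex: if it is dead, recurse; if it survives, either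
-- p moves among the other vertices, or p takes an edge {0,v} and the result is
-- read off the subtree of X_k,q in which vertex 0 is dead.  Each recursion makes
-- two calls on trees of depth one less, hence a total time of poly(n) 2^n.

open import Data.Bool using (Bool; true; false; T; _∧_; _∨_; not; if_then_else_)
open import Data.Bool.Properties using (∧-zeroʳ; ∨-zeroʳ)
open import Data.Fin using (Fin; zero; suc; #_; _≟_)
open import Data.Fin.Subset using (∣_∣)
open import Data.Fin.Subset.Properties using (∣p∣≤n)
open import Data.List using (List; []; _∷_; _++_)
open import Data.Maybe using (Maybe; just; nothing)
open import Data.Nat using (ℕ; zero; suc; _+_; _*_; _^_; _≤_; _<_; _≤ᵇ_; z≤n; s≤s)
open import Data.Nat.ListAction using (sum)
open import Data.Nat.ListAction.Properties using (sum-++)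
open import Data.Nat.Properties hiding (_≟_)
open import Data.Nat.Tactic.RingSolver using (solve-∀)
open import Data.Product using (Σ-syntax; ∃-syntax; ∃₂; _×_; _,_)
open import Data.Sum using (_⊎_; inj₁; inj₂)
open import Data.Vec using (Vec; []; _∷_; lookup; tabulate; replicate; _[_]≔_)
open import Data.Vec.Properties using (lookup∘update; lookup∘update′; lookup-replicate)
open import Function using (_∘_; case_of_)
open import Relation.Binary.PropositionalEquality
open import Relation.Nullary using (does; yes; no; contradiction)
open import Defs

-- Asymptotics

-- The base `suc n` keeps the polynomial factor positive at n = 0 and monotone in d, so that bounds
-- of different degrees can be added.
IsO*2ⁿ : (ℕ → ℕ) → Set
IsO*2ⁿ f = Σ[ c ∈ ℕ ] Σ[ d ∈ ℕ ] (∀ n → f n ≤ c * suc n ^ d * 2 ^ n)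

constant-IsO*2ⁿ : ∀ a → IsO*2ⁿ (λ _ → a)
constant-IsO*2ⁿ a = a , 0 , λ n → begin
  a                ≡⟨ *-identityʳ a ⟨
  a * 1            ≡⟨ *-identityʳ (a * 1) ⟨
  a * 1 * 1        ≤⟨ *-monoʳ-≤ (a * 1) (m^n>0 2 n) ⟩
  a * 1 * 2 ^ n    ∎
  where open ≤-Reasoning

+-IsO*2ⁿ : ∀ {f g} → IsO*2ⁿ f → IsO*2ⁿ g → IsO*2ⁿ (λ n → f n + g n)
+-IsO*2ⁿ {f} {g} (c , d , f≤) (c′ , d′ , g≤) = c + c′ , d + d′ , λ n → begin
  f n + g n
    ≤⟨ +-mono-≤ (f≤ n) (g≤ n) ⟩
  c * suc n ^ d * 2 ^ n + c′ * suc n ^ d′ * 2 ^ n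
    ≤⟨ +-mono-≤ (*-monoˡ-≤ (2 ^ n) (*-monoʳ-≤ c (^-monoʳ-≤ (suc n) (m≤m+n d d′))))
                (*-monoˡ-≤ (2 ^ n) (*-monoʳ-≤ c′ (^-monoʳ-≤ (suc n) (m≤n+m d′ d)))) ⟩
  c * suc n ^ (d + d′) * 2 ^ n + c′ * suc n ^ (d + d′) * 2 ^ n
    ≡⟨ collect c c′ (suc n ^ (d + d′)) (2 ^ n) ⟩
  (c + c′) * suc n ^ (d + d′) * 2 ^ n ∎
  where
  open ≤-Reasoning
  collect : ∀ c c′ s e → c * s * e + c′ * s * e ≡ (c + c′) * s * e
  collect = solve-∀

n*-IsO*2ⁿ : ∀ {f} → IsO*2ⁿ f → IsO*2ⁿ (λ n → n * f n)
n*-IsO*2ⁿ {f} (c , d , f≤) = c , suc d , λ n → begin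
  n * f n                         ≤⟨ *-mono-≤ (n≤1+n n) (f≤ n) ⟩
  suc n * (c * suc n ^ d * 2 ^ n) ≡⟨ rearrange (suc n) c (suc n ^ d) (2 ^ n) ⟩
  c * suc n ^ suc d * 2 ^ n       ∎
  where
  open ≤-Reasoning
  rearrange : ∀ s c x e → s * (c * x * e) ≡ c * (s * x) * e
  rearrange = solve-∀

-- The recurrence of a procedure that does `g n` work on a tree of depth n + 1 and recurses into
-- both halves.
doubling : ℕ → (ℕ → ℕ) → ℕ → ℕ
doubling a g zero    = a
doubling a g (suc n) = g n + 2 * doubling a g n

-- Unrolled, each of the n levels contributes at most a polynomial times 2^n, so the recursion
-- raises the degree by one and leaves the base 2 unchanged.
doubling-IsO*2ⁿ : ∀ a {g} → IsO*2ⁿ g → IsO*2ⁿ (doubling a g)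
doubling-IsO*2ⁿ a {g} (c , d , g≤) = a + c , suc d , bound
  where
  open ≤-Reasoning
  base : ∀ a c x → a + c * x ≡ (a + c * x) * 1 * 1
  base = solve-∀
  rearrange : ∀ a c n x e →
    (a + c) * x * e + 2 * ((a + c) * ((1 + n) * x) * e) + (a + c) * x * e
      ≡ (a + c) * ((2 + n) * x) * (2 * e)
  rearrange = solve-∀
  bound : ∀ n → doubling a g n ≤ (a + c) * suc n ^ suc d * 2 ^ n
  bound zero = begin
    a                            ≤⟨ m≤m+n a c ⟩
    a + c                        ≡⟨ *-identityʳ (a + c) ⟨
    (a + c) * 1                  ≡⟨ cong ((a + c) *_) (^-zeroˡ (suc d)) ⟨
    (a + c) * 1 ^ suc d          ≡⟨ *-identityʳ _ ⟨
    (a + c) * 1 ^ suc d * 1      ∎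
  bound (suc n) = begin
    g n + 2 * doubling a g n
      ≤⟨ +-mono-≤ (≤-trans (g≤ n) (*-monoˡ-≤ e (*-monoˡ-≤ x (m≤n+m c a))))
                  (*-monoʳ-≤ 2 (bound n)) ⟩
    (a + c) * x * e + 2 * ((a + c) * (suc n * x) * e)
      -- Passing from the factor n + 1 to n + 2 makes room for twice (a + c) * x * e. The term from
      -- `g n` fills one half; this summand fills the other.
      ≤⟨ m≤m+n _ ((a + c) * x * e) ⟩
    (a + c) * x * e + 2 * ((a + c) * (suc n * x) * e) + (a + c) * x * e
      ≡⟨ rearrange a c n x e ⟩
    (a + c) * ((2 + n) * x) * (2 * e)
      ≤⟨ *-monoˡ-≤ (2 * e) (*-monoʳ-≤ (a + c) (*-monoʳ-≤ (2 + n) (^-monoˡ-≤ d (n≤1+n (suc n))))) ⟩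
    (a + c) * (2 + n) ^ suc d * 2 ^ suc n ∎
    where
    x = suc n ^ d
    e = 2 ^ n

-- Time-bounded evaluation

-- The time bound is kept as k + sum xs, with k closed and xs the bounds of the
-- calls made, so that k is computed by the type checker.
data Within (t k : ℕ) (xs : List ℕ) : Set where
  within : t ≤ k + sum xs → Within t k xs

record Runs {m} (fs : Vec (Exp m 1) m) {j} (ρ : Vec Tree j) (e : Exp m j)
            (v : Tree) (k : ℕ) (xs : List ℕ) : Set where
  constructor runs
  field
    {time}     : ℕ
    evaluation : Eval fs ρ e v time
    bound      : Within time k xs

both : ∀ {t₁ t₂ k₁ k₂ xs₁ xs₂} → Within t₁ k₁ xs₁ → Within t₂ k₂ xs₂ →
       Within (suc (t₁ + t₂)) (suc (k₁ + k₂)) (xs₁ ++ xs₂)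
both {t₁} {t₂} {k₁} {k₂} {xs₁} {xs₂} (within p) (within q) = within (s≤s (begin
  t₁ + t₂                           ≤⟨ +-mono-≤ p q ⟩
  k₁ + sum xs₁ + (k₂ + sum xs₂)     ≡⟨ interchange k₁ (sum xs₁) k₂ (sum xs₂) ⟩
  k₁ + k₂ + (sum xs₁ + sum xs₂)     ≡⟨ cong (k₁ + k₂ +_) (sum-++ xs₁ xs₂) ⟨
  k₁ + k₂ + sum (xs₁ ++ xs₂)        ∎))
  where
  open ≤-Reasoning
  interchange : ∀ a b c d → a + b + (c + d) ≡ a + c + (b + d)
  interchange = solve-∀

module _ {m} {fs : Vec (Exp m 1) m} {j} {ρ : Vec Tree j} where

  weaken : ∀ {e v k xs k′ xs′} → Runs fs ρ e v k xs →
           k + sum xs ≤ k′ + sum xs′ → Runs fs ρ e v k′ xs′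
  weaken (runs ev (within t≤)) le = runs ev (within (≤-trans t≤ le))

  -- For closed k and k′ the implicit argument computes to the unit type and is filled in silently.
  -- Exact step counts become the constants 20, 40 and 80 in this way.
  roundUp : ∀ {e v k xs} k′ {_ : T (k ≤ᵇ k′)} →
            Runs fs ρ e v k xs → Runs fs ρ e v k′ xs
  roundUp {xs = xs} k′ {k≤k′} r = weaken r (+-monoˡ-≤ (sum xs) (≤ᵇ⇒≤ _ k′ k≤k′))

  varᴿ : ∀ {i} → Runs fs ρ (var i) (lookup ρ i) 1 []
  varᴿ = runs (var _) (within ≤-refl)

  nilᴿ : Runs fs ρ nil nil 1 []
  nilᴿ = runs nil (within ≤-refl)

  consᴿ : ∀ {e₁ e₂ v₁ v₂ k₁ k₂ xs₁ xs₂} →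
          Runs fs ρ e₁ v₁ k₁ xs₁ → Runs fs ρ e₂ v₂ k₂ xs₂ →
          Runs fs ρ (cons e₁ e₂) (v₁ ∙ v₂) (suc (k₁ + k₂)) (xs₁ ++ xs₂)
  consᴿ (runs ev₁ p) (runs ev₂ q) = runs (cons ev₁ ev₂) (both p q)

  letinᴿ : ∀ {e₁ e₂ v₁ v₂ k₁ k₂ xs₁ xs₂} →
           Runs fs ρ e₁ v₁ k₁ xs₁ → Runs fs (v₁ ∷ ρ) e₂ v₂ k₂ xs₂ →
           Runs fs ρ (letin e₁ e₂) v₂ (suc (k₁ + k₂)) (xs₁ ++ xs₂)
  letinᴿ (runs ev₁ p) (runs ev₂ q) = runs (letin ev₁ ev₂) (both p q)

  match-nilᴿ : ∀ {e e₁ e₂ v k₁ k₂ xs₁ xs₂} →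
               Runs fs ρ e nil k₁ xs₁ → Runs fs ρ e₁ v k₂ xs₂ →
               Runs fs ρ (match e e₁ e₂) v (suc (k₁ + k₂)) (xs₁ ++ xs₂)
  match-nilᴿ (runs ev₁ p) (runs ev₂ q) = runs (match-nil ev₁ ev₂) (both p q)

  match-consᴿ : ∀ {e e₁ e₂ v₁ v₂ v k₁ k₂ xs₁ xs₂} →
                Runs fs ρ e (v₁ ∙ v₂) k₁ xs₁ → Runs fs (v₁ ∷ v₂ ∷ ρ) e₂ v k₂ xs₂ →
                Runs fs ρ (match e e₁ e₂) v (suc (k₁ + k₂)) (xs₁ ++ xs₂)
  match-consᴿ (runs ev₁ p) (runs ev₂ q) = runs (match-cons ev₁ ev₂) (both p q)

  callᴿ : ∀ {f e v w k₁ k₂ xs₁ xs₂} →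
          Runs fs ρ e v k₁ xs₁ → Runs fs (v ∷ []) (lookup fs f) w k₂ xs₂ →
          Runs fs ρ (call f e) w (suc (k₁ + k₂)) (xs₁ ++ xs₂)
  callᴿ (runs ev₁ p) (runs ev₂ q) = runs (call ev₁ ev₂) (both p q)

-- The tables and their encoding

Position : ℕ → Set
Position = Vec Bool

Table : ℕ → Set
Table n = Position n → Bool

orNot : ∀ {n} → Table n → Table n → Table n
orNot X Y S = X S ∨ not (Y S)

mayChoose : Player → Maybe Colour → Bool
mayChoose p nothing      = false
mayChoose p (just gray)  = true
mayChoose B (just black) = true
mayChoose W (just black) = false
mayChoose B (just white) = false
mayChoose W (just white) = true

-- Adds the moves along the edges at one fixed live vertex outside S, with r their colours. X
-- accumulates the wins found so far; Y is the opponent's table with the fixed vertex dead, and a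
-- live v with a permitted edge contributes the negation of Y at S with v cleared.
extend : ∀ {n} → Player → (Fin n → Maybe Colour) → Table n → Table n → Table n
extend p r X Y []          = X []
extend p r X Y (false ∷ S) = extend p (r ∘ suc) (X ∘ (false ∷_)) (Y ∘ (false ∷_)) S
extend p r X Y (true ∷ S)  =
  extend p (r ∘ suc)
    (if mayChoose p (r zero) then orNot (X ∘ (true ∷_)) (Y ∘ (false ∷_)) else X ∘ (true ∷_))
    (Y ∘ (true ∷_)) S

dropVertex : ∀ {n} → ColoredGraph (suc n) → ColoredGraph n
dropVertex G .colour u v    = colour G (suc u) (suc v)
dropVertex G .symmetric u v = symmetric G (suc u) (suc v)
dropVertex G .loopless u    = loopless G (suc u)

step : ∀ {n} → Player → ColoredGraph n → Table n → Table n
step p G Y []          = false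
step p G Y (false ∷ S) = step p (dropVertex G) (Y ∘ (false ∷_)) S
step p G Y (true ∷ S)  =
  -- Every edge is tried from its smaller endpoint only.
  extend p (colour G zero ∘ suc) (step p (dropVertex G) (Y ∘ (true ∷_))) (Y ∘ (false ∷_)) S

-- The tables X_k,p; the constant `false` at k = 0 declares the player to move the loser.
wins : ∀ {n} → ColoredGraph n → ℕ → Player → Table n
wins G zero    p = λ _ → false
wins G (suc k) p = step p G (wins G k (opponent p))

encodeBool : Bool → Tree
encodeBool false = nil
encodeBool true  = nil ∙ nil

encodeTable : ∀ n → Table n → Tree
encodeTable zero    X = encodeBool (X [])
encodeTable (suc n) X = encodeTable n (X ∘ (false ∷_)) ∙ encodeTable n (X ∘ (true ∷_))

encodeList : ∀ {n} → (Fin n → Tree) → Tree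
encodeList f = encodeVec (tabulate f)

-- The program

orNotᶠ mayChooseᶠ extendᶠ tailsᶠ stepᶠ emptyᶠ roundsᶠ lastᶠ : Fin 8
orNotᶠ     = # 0
mayChooseᶠ = # 1
extendᶠ    = # 2
tailsᶠ     = # 3
stepᶠ      = # 4
emptyᶠ     = # 5
roundsᶠ    = # 6
lastᶠ      = # 7

-- The default `nil` is never reached on valid encodings: `split` is applied only where the value is
-- known to be a node.
split : ∀ {m k} → Exp m k → Exp m (suc (suc k)) → Exp m k
split e = match e nil

-- A depth argument d is any list of the right length: a leaf cannot be told from
-- an inner node by its shape.  Trailing comments list the innermost variables in
-- scope, index 0 first.

orNotBody : Exp 8 1
orNotBody =
  split (var (# 0))                              -- d xy
  (split (var (# 1))                             -- x y d
  (match (var (# 2))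
    -- At a leaf, x ∨ not y is true if y is false, and x otherwise.
    (match (var (# 1)) (cons nil nil) (var (# 2)))
    (split (var (# 2))                           -- x₀ x₁ _ d′ x y
    (split (var (# 5))                           -- y₀ y₁ x₀ x₁ _ d′
    (cons
      (call orNotᶠ (cons (var (# 5)) (cons (var (# 2)) (var (# 0)))))
      (call orNotᶠ (cons (var (# 5)) (cons (var (# 3)) (var (# 1))))))))))

mayChooseBody : Exp 8 1
mayChooseBody =
  split (var (# 0))                              -- p e
  (match (var (# 1))
    nil
    (match (var (# 0))                           -- e₀ e₁ p e
      -- Gray gives true. For white the code of p is itself the answer, since W and `true` have the
      -- same encoding, as do B and `false`.
      (match (var (# 1)) (cons nil nil) (var (# 4)))
      (match (var (# 4)) (cons nil nil) nil)))

extendBody : Exp 8 1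
extendBody =
  split (var (# 0))                              -- r pxy
  (split (var (# 1))                             -- p xy r
  (split (var (# 1))                             -- x y p xy r
  (match (var (# 4))
    (var (# 0))
    (split (var (# 2))                           -- x₀ x₁ e r′ x y p
    (split (var (# 5))                           -- y₀ y₁ x₀ x₁ e r′ x y p
    (cons
      (call extendᶠ (cons (var (# 5)) (cons (var (# 8)) (cons (var (# 2)) (var (# 0))))))
      (call extendᶠ (cons (var (# 5)) (cons (var (# 8)) (cons
        (match (call mayChooseᶠ (cons (var (# 8)) (var (# 4))))
          (var (# 3))
          (call orNotᶠ (cons (var (# 7)) (cons (var (# 5)) (var (# 2))))))
        (var (# 1))))))))))))

tailsBody : Exp 8 1
tailsBody =
  match (var (# 0))
    nil
    (cons (split (var (# 0)) (var (# 1))) (call tailsᶠ (var (# 1))))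

stepBody : Exp 8 1
stepBody =
  split (var (# 0))                              -- rs py
  (split (var (# 1))                             -- p y rs
  (match (var (# 2))
    nil
    (split (var (# 0))                           -- _ r′ r rs′ p y
    (split (var (# 5))                           -- y₀ y₁ _ r′ r rs′ p
    -- The first row is already split off; removing the first column gives the matrix of
    -- `dropVertex`, bound once for both recursive calls.
    (letin (call tailsᶠ (var (# 5)))             -- m y₀ y₁ _ r′ r rs′ p
    (cons
      (call stepᶠ (cons (var (# 0)) (cons (var (# 7)) (var (# 1)))))
      (call extendᶠ (cons (var (# 4)) (cons (var (# 7)) (cons
        (call stepᶠ (cons (var (# 0)) (cons (var (# 7)) (var (# 2)))))
        (var (# 1))))))))))))

emptyBody : Exp 8 1
emptyBody =
  match (var (# 0))
    nil
    (letin (call emptyᶠ (var (# 1))) (cons (var (# 0)) (var (# 0))))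

roundsBody : Exp 8 1
roundsBody =
  split (var (# 0))                              -- k rs
  (match (var (# 0))
    (letin (call emptyᶠ (var (# 1))) (cons (var (# 0)) (var (# 0))))
    (split (call roundsᶠ (cons (var (# 1)) (var (# 3))))  -- b w _ k′ k rs
    (cons
      -- The tables cross over: B's next table is computed from W's, and W's from B's.
      (call stepᶠ (cons (var (# 5)) (cons nil (var (# 1)))))
      (call stepᶠ (cons (var (# 5)) (cons (cons nil nil) (var (# 0))))))))

-- The full vertex set sits at the end of the path that always turns right.
lastBody : Exp 8 1
lastBody =
  split (var (# 0))                              -- d x
  (match (var (# 0))
    (var (# 1))
    (split (var (# 3))                           -- x₀ x₁ _ d′
    (call lastᶠ (cons (var (# 3)) (var (# 1))))))

solver : Program
solver .Program.functions = 8
solver .Program.bodies =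
  orNotBody ∷ mayChooseBody ∷ extendBody ∷ tailsBody ∷
  stepBody ∷ emptyBody ∷ roundsBody ∷ lastBody ∷ []
solver .Program.main =
  split (var (# 0))                              -- p rs
  -- A matrix with n rows is also a list of length n, so it serves as the round counter too.
  (split (call roundsᶠ (cons (var (# 1)) (var (# 1))))   -- b w p rs
  (match (var (# 2))
    (match (call lastᶠ (cons (var (# 3)) (var (# 0)))) (cons nil nil) nil)
    (match (call lastᶠ (cons (var (# 5)) (var (# 3)))) nil (cons nil nil))))

_⟶_⟨_,_⟩ : Fin 8 × Tree → Tree → ℕ → List ℕ → Set
(f , x) ⟶ v ⟨ k , xs ⟩ = Runs fs (x ∷ []) (lookup fs f) v k xs
  where fs = Program.bodies solver

-- Running the program

-- The linear-time functions are also counted as doubling, which is coarse but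
-- stays within the bound.
orNotCost extendCost tailsCost stepCost emptyCost lastCost : ℕ → ℕ
orNotCost  = doubling 20 (λ _ → 40)
extendCost = doubling 20 (λ n → 80 + orNotCost n)
tailsCost  = doubling 20 (λ _ → 20)
stepCost   = doubling 20 (λ n → 80 + (tailsCost n + extendCost n))
emptyCost  = doubling 20 (λ _ → 20)
lastCost   = doubling 20 (λ _ → 20)

roundsCost : ℕ → ℕ → ℕ
roundsCost n zero    = 20 + emptyCost n
roundsCost n (suc k) = 40 + 2 * stepCost n + roundsCost n k

orNot-runs : ∀ n (d : Fin n → Tree) (X Y : Table n) →
  (orNotᶠ , encodeList d ∙ (encodeTable n X ∙ encodeTable n Y))
    ⟶ encodeTable n (orNot X Y) ⟨ 0 , orNotCost n ∷ [] ⟩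
orNot-runs zero d X Y = weaken (leaf (X []) (Y [])) ≤-refl
  where
  leaf : ∀ x y → (orNotᶠ , nil ∙ (encodeBool x ∙ encodeBool y))
           ⟶ encodeBool (x ∨ not y) ⟨ 20 , [] ⟩
  leaf false false = roundUp 20
    (match-consᴿ varᴿ (match-consᴿ varᴿ (match-nilᴿ varᴿ (match-nilᴿ varᴿ (consᴿ nilᴿ nilᴿ)))))
  leaf true false = roundUp 20
    (match-consᴿ varᴿ (match-consᴿ varᴿ (match-nilᴿ varᴿ (match-nilᴿ varᴿ (consᴿ nilᴿ nilᴿ)))))
  leaf false true = roundUp 20
    (match-consᴿ varᴿ (match-consᴿ varᴿ (match-nilᴿ varᴿ (match-consᴿ varᴿ varᴿ))))
  leaf true true = roundUp 20
    (match-consᴿ varᴿ (match-consᴿ varᴿ (match-nilᴿ varᴿ (match-consᴿ varᴿ varᴿ))))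
orNot-runs (suc n) d X Y = weaken (roundUp 40
  (match-consᴿ varᴿ (match-consᴿ varᴿ (match-consᴿ varᴿ
    (match-consᴿ varᴿ (match-consᴿ varᴿ (consᴿ
      (callᴿ (consᴿ varᴿ (consᴿ varᴿ varᴿ)) (orNot-runs n (d ∘ suc) (X ∘ (false ∷_)) (Y ∘ (false ∷_))))
      (callᴿ (consᴿ varᴿ (consᴿ varᴿ varᴿ)) (orNot-runs n (d ∘ suc) (X ∘ (true ∷_)) (Y ∘ (true ∷_)))))))))))
  (≤-reflexive (sym (+-identityʳ _)))

mayChoose-runs : ∀ p e →
  (mayChooseᶠ , encodePlayer p ∙ encodeEntry e) ⟶ encodeBool (mayChoose p e) ⟨ 20 , [] ⟩
mayChoose-runs p nothing = roundUp 20 (match-consᴿ varᴿ (match-nilᴿ varᴿ nilᴿ))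
mayChoose-runs p (just gray) = roundUp 20
  (match-consᴿ varᴿ (match-consᴿ varᴿ (match-nilᴿ varᴿ (match-nilᴿ varᴿ (consᴿ nilᴿ nilᴿ)))))
mayChoose-runs B (just black) = roundUp 20
  (match-consᴿ varᴿ (match-consᴿ varᴿ (match-consᴿ varᴿ (match-nilᴿ varᴿ (consᴿ nilᴿ nilᴿ)))))
mayChoose-runs W (just black) = roundUp 20
  (match-consᴿ varᴿ (match-consᴿ varᴿ (match-consᴿ varᴿ (match-consᴿ varᴿ nilᴿ))))
mayChoose-runs B (just white) = roundUp 20
  (match-consᴿ varᴿ (match-consᴿ varᴿ (match-nilᴿ varᴿ (match-consᴿ varᴿ varᴿ))))
mayChoose-runs W (just white) = roundUp 20
  (match-consᴿ varᴿ (match-consᴿ varᴿ (match-nilᴿ varᴿ (match-consᴿ varᴿ varᴿ))))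

-- One bound, paying for both branches, holds whatever b is; this spares `extend-runs` a case
-- distinction on whether the edge may be chosen.
ifTable-runs : ∀ {j} {ρ : Vec Tree j} {e e₀ e₁} n b {X Y : Table n} {k k₀ k₁ x} →
  Runs (Program.bodies solver) ρ e (encodeBool b) k [] →
  Runs (Program.bodies solver) ρ e₀ (encodeTable n Y) k₀ [] →
  Runs (Program.bodies solver) (nil ∷ nil ∷ ρ) e₁ (encodeTable n X) k₁ (x ∷ []) →
  Runs (Program.bodies solver) ρ (match e e₀ e₁) (encodeTable n (if b then X else Y))
    (suc (k + (k₀ + k₁))) (x ∷ [])
ifTable-runs n false {k = k} {k₀} r r₀ _ =
  weaken (match-nilᴿ r r₀) (+-mono-≤ (s≤s (+-monoʳ-≤ k (m≤m+n k₀ _))) z≤n)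
ifTable-runs n true {k = k} {k₀} {k₁} r _ r₁ =
  weaken (match-consᴿ r r₁) (+-monoˡ-≤ _ (s≤s (+-monoʳ-≤ k (m≤n+m k₁ k₀))))

extend-runs : ∀ n p (r : Fin n → Maybe Colour) (X Y : Table n) →
  (extendᶠ , encodeList (encodeEntry ∘ r) ∙ (encodePlayer p ∙ (encodeTable n X ∙ encodeTable n Y)))
    ⟶ encodeTable n (extend p r X Y) ⟨ 0 , extendCost n ∷ [] ⟩
extend-runs zero p r X Y = weaken (roundUp 20
  (match-consᴿ varᴿ (match-consᴿ varᴿ (match-consᴿ varᴿ (match-nilᴿ varᴿ varᴿ)))))
  ≤-refl
extend-runs (suc n) p r X Y = weaken (roundUp 80
  (match-consᴿ varᴿ (match-consᴿ varᴿ (match-consᴿ varᴿ (match-consᴿ varᴿ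
    (match-consᴿ varᴿ (match-consᴿ varᴿ (consᴿ
      (callᴿ (consᴿ varᴿ (consᴿ varᴿ (consᴿ varᴿ varᴿ)))
             (extend-runs n p (r ∘ suc) (X ∘ (false ∷_)) (Y ∘ (false ∷_))))
      (callᴿ (consᴿ varᴿ (consᴿ varᴿ (consᴿ
               (ifTable-runs n (mayChoose p (r zero))
                 (callᴿ (consᴿ varᴿ varᴿ) (mayChoose-runs p (r zero)))
                 varᴿ
                 (callᴿ (consᴿ varᴿ (consᴿ varᴿ varᴿ))
                        (orNot-runs n (encodeEntry ∘ r ∘ suc) (X ∘ (true ∷_)) (Y ∘ (false ∷_)))))
               varᴿ)))
             (extend-runs n p (r ∘ suc) _ (Y ∘ (true ∷_))))))))))))
  (≤-reflexive (rearrange (extendCost n) (orNotCost n)))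
  where
  rearrange : ∀ x y → 80 + (x + (y + (x + 0))) ≡ 80 + y + (x + (x + 0)) + 0
  rearrange = solve-∀

-- Rows and columns are counted separately because the recursion consumes rows of a fixed, positive
-- length.
tails-runs : ∀ {m n} (M : Fin m → Fin (suc n) → Tree) →
  (tailsᶠ , encodeList (λ u → encodeList (M u)))
    ⟶ encodeList (λ u → encodeList (M u ∘ suc)) ⟨ 0 , tailsCost m ∷ [] ⟩
tails-runs {zero} M = weaken (roundUp 20 (match-nilᴿ varᴿ nilᴿ)) ≤-refl
tails-runs {suc m} M = weaken (roundUp 20
  (match-consᴿ varᴿ (consᴿ (match-consᴿ varᴿ varᴿ) (callᴿ varᴿ (tails-runs (M ∘ suc))))))
  (+-monoʳ-≤ 20 (≤-trans (+-monoʳ-≤ x z≤n) (m≤m+n _ 0)))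
  where x = tailsCost m

step-runs : ∀ n p (G : ColoredGraph n) (Y : Table n) →
  (stepᶠ , encodeGraph G ∙ (encodePlayer p ∙ encodeTable n Y))
    ⟶ encodeTable n (step p G Y) ⟨ 0 , stepCost n ∷ [] ⟩
step-runs zero p G Y = weaken (roundUp 20
  (match-consᴿ varᴿ (match-consᴿ varᴿ (match-nilᴿ varᴿ nilᴿ))))
  ≤-refl
step-runs (suc n) p G Y =
  weaken (roundUp 80
  (match-consᴿ varᴿ (match-consᴿ varᴿ (match-consᴿ varᴿ
    (match-consᴿ varᴿ (match-consᴿ varᴿ
    (letinᴿ (callᴿ varᴿ (tails-runs (λ u v → encodeEntry (colour G (suc u) v))))
    (consᴿ
      (callᴿ (consᴿ varᴿ (consᴿ varᴿ varᴿ)) (step-runs n p (dropVertex G) (Y ∘ (false ∷_))))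
      (callᴿ (consᴿ varᴿ (consᴿ varᴿ (consᴿ
               (callᴿ (consᴿ varᴿ (consᴿ varᴿ varᴿ)) (step-runs n p (dropVertex G) (Y ∘ (true ∷_))))
               varᴿ)))
             (extend-runs n p (colour G zero ∘ suc) (step p (dropVertex G) (Y ∘ (true ∷_)))
                (Y ∘ (false ∷_))))))))))))
  (≤-reflexive (rearrange (tailsCost n) (stepCost n) (extendCost n)))
  where
  rearrange : ∀ x y z → 80 + (x + (y + (y + (z + 0)))) ≡ 80 + (x + z) + (y + (y + 0)) + 0
  rearrange = solve-∀

empty-runs : ∀ n (d : Fin n → Tree) →
  (emptyᶠ , encodeList d) ⟶ encodeTable n (λ _ → false) ⟨ 0 , emptyCost n ∷ [] ⟩
empty-runs zero d = weaken (roundUp 20 (match-nilᴿ varᴿ nilᴿ)) ≤-refl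
empty-runs (suc n) d = weaken (roundUp 20
  (match-consᴿ varᴿ (letinᴿ (callᴿ varᴿ (empty-runs n (d ∘ suc))) (consᴿ varᴿ varᴿ))))
  (+-monoʳ-≤ 20 (≤-trans (+-monoʳ-≤ x z≤n) (m≤m+n _ 0)))
  where x = emptyCost n

rounds-runs : ∀ {n} (G : ColoredGraph n) k (d : Fin k → Tree) →
  (roundsᶠ , encodeList d ∙ encodeGraph G)
    ⟶ encodeTable n (wins G k B) ∙ encodeTable n (wins G k W) ⟨ 0 , roundsCost n k ∷ [] ⟩
rounds-runs {n} G zero d = weaken (roundUp 20
  (match-consᴿ varᴿ (match-nilᴿ varᴿ (letinᴿ (callᴿ varᴿ (empty-runs n _)) (consᴿ varᴿ varᴿ)))))
  ≤-refl
rounds-runs {n} G (suc k) d =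
  weaken (roundUp 40
  (match-consᴿ varᴿ (match-consᴿ varᴿ
    (match-consᴿ (callᴿ (consᴿ varᴿ varᴿ) (rounds-runs G k (d ∘ suc)))
    (consᴿ
      (callᴿ (consᴿ varᴿ (consᴿ nilᴿ varᴿ)) (step-runs n B G (wins G k W)))
      (callᴿ (consᴿ varᴿ (consᴿ (consᴿ nilᴿ nilᴿ) varᴿ)) (step-runs n W G (wins G k B))))))))
  (≤-reflexive (rearrange (roundsCost n k) (stepCost n)))
  where
  rearrange : ∀ x y → 40 + (x + (y + (y + 0))) ≡ 40 + (y + (y + 0)) + x + 0
  rearrange = solve-∀

last-runs : ∀ n (d : Fin n → Tree) (X : Table n) →
  (lastᶠ , encodeList d ∙ encodeTable n X)
    ⟶ encodeBool (X (replicate n true)) ⟨ 0 , lastCost n ∷ [] ⟩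
last-runs zero d X = weaken (roundUp 20 (match-consᴿ varᴿ (match-nilᴿ varᴿ varᴿ))) ≤-refl
last-runs (suc n) d X = weaken (roundUp 20
  (match-consᴿ varᴿ (match-consᴿ varᴿ (match-consᴿ varᴿ
    (callᴿ (consᴿ varᴿ varᴿ) (last-runs n (d ∘ suc) (X ∘ (true ∷_))))))))
  (+-monoʳ-≤ 20 (≤-trans (+-monoʳ-≤ x z≤n) (m≤m+n _ 0)))
  where x = lastCost n

winner : Player → Bool → Player
winner p true  = p
winner p false = opponent p

-- Written with the final `+ 0` so as to be definitionally the bound in `solver-runs`.
solverCost : ℕ → ℕ
solverCost n = 40 + (roundsCost n n + (lastCost n + 0))

solver-runs : ∀ {n} (G : ColoredGraph n) p →
  Runs (Program.bodies solver) (encodeInput G p ∷ []) (Program.main solver)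
    (encodePlayer (winner p (wins G n p (replicate n true)))) 40 (roundsCost n n ∷ lastCost n ∷ [])
solver-runs {n} G B
  -- Abstracting the Boolean together with `last-runs` turns the output of that call into a concrete
  -- tree, which selects the branch of `match`.
  with wins G n B (replicate n true)
     | last-runs n (λ u → encodeList (encodeEntry ∘ colour G u)) (wins G n B)
... | false | lastR = roundUp 40 (match-consᴿ varᴿ
  (match-consᴿ (callᴿ (consᴿ varᴿ varᴿ) (rounds-runs G n _))
  (match-nilᴿ varᴿ (match-nilᴿ (callᴿ (consᴿ varᴿ varᴿ) lastR) (consᴿ nilᴿ nilᴿ)))))
... | true | lastR = roundUp 40 (match-consᴿ varᴿ
  (match-consᴿ (callᴿ (consᴿ varᴿ varᴿ) (rounds-runs G n _))
  (match-nilᴿ varᴿ (match-consᴿ (callᴿ (consᴿ varᴿ varᴿ) lastR) nilᴿ))))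
solver-runs {n} G W
  with wins G n W (replicate n true)
     | last-runs n (λ u → encodeList (encodeEntry ∘ colour G u)) (wins G n W)
... | false | lastR = roundUp 40 (match-consᴿ varᴿ
  (match-consᴿ (callᴿ (consᴿ varᴿ varᴿ) (rounds-runs G n _))
  (match-consᴿ varᴿ (match-nilᴿ (callᴿ (consᴿ varᴿ varᴿ) lastR) nilᴿ))))
... | true | lastR = roundUp 40 (match-consᴿ varᴿ
  (match-consᴿ (callᴿ (consᴿ varᴿ varᴿ) (rounds-runs G n _))
  (match-consᴿ varᴿ (match-consᴿ (callᴿ (consᴿ varᴿ varᴿ) lastR) (consᴿ nilᴿ nilᴿ)))))

-- Total running time

n≤size-encodeList : ∀ {n} (f : Fin n → Tree) → n ≤ size (encodeList f)
n≤size-encodeList {zero}  f = z≤n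
n≤size-encodeList {suc n} f = s≤s (≤-trans (n≤size-encodeList (f ∘ suc)) (m≤n+m _ (size (f zero))))

-- The closure lemmas concern functions of one variable; on the diagonal k = n this form is a sum to
-- which they apply.
roundsCost-closed : ∀ n k → roundsCost n k ≡ k * (40 + 2 * stepCost n) + (20 + emptyCost n)
roundsCost-closed n zero    = refl
roundsCost-closed n (suc k) =
  trans (cong (40 + 2 * stepCost n +_) (roundsCost-closed n k))
        (sym (+-assoc (40 + 2 * stepCost n) (k * (40 + 2 * stepCost n)) (20 + emptyCost n)))

-- Abstract, lest the type checker unfold the constants.
abstract
  solverCost-IsO*2ⁿ : IsO*2ⁿ solverCost
  solverCost-IsO*2ⁿ = +-IsO*2ⁿ {λ _ → 40} (constant-IsO*2ⁿ 40)
    (+-IsO*2ⁿ {λ n → roundsCost n n} rounds (+-IsO*2ⁿ {lastCost} {λ _ → 0} linear (constant-IsO*2ⁿ 0)))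
    where
    linear : IsO*2ⁿ (doubling 20 (λ _ → 20))
    linear = doubling-IsO*2ⁿ 20 (constant-IsO*2ⁿ 20)
    orNot′ : IsO*2ⁿ orNotCost
    orNot′ = doubling-IsO*2ⁿ 20 (constant-IsO*2ⁿ 40)
    extend′ : IsO*2ⁿ extendCost
    extend′ = doubling-IsO*2ⁿ 20 (+-IsO*2ⁿ {λ _ → 80} {orNotCost} (constant-IsO*2ⁿ 80) orNot′)
    step′ : IsO*2ⁿ stepCost
    step′ = doubling-IsO*2ⁿ 20 (+-IsO*2ⁿ {λ _ → 80} {λ n → tailsCost n + extendCost n}
      (constant-IsO*2ⁿ 80) (+-IsO*2ⁿ {tailsCost} {extendCost} linear extend′))
    twice : IsO*2ⁿ (λ n → 2 * stepCost n)
    twice = +-IsO*2ⁿ {stepCost} {λ n → stepCost n + 0} step′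
      (+-IsO*2ⁿ {stepCost} {λ _ → 0} step′ (constant-IsO*2ⁿ 0))
    round′ : IsO*2ⁿ (λ n → 40 + 2 * stepCost n)
    round′ = +-IsO*2ⁿ {λ _ → 40} {λ n → 2 * stepCost n} (constant-IsO*2ⁿ 40) twice
    closed : IsO*2ⁿ (λ n → n * (40 + 2 * stepCost n) + (20 + emptyCost n))
    closed = +-IsO*2ⁿ {λ n → n * (40 + 2 * stepCost n)} {λ n → 20 + emptyCost n}
      (n*-IsO*2ⁿ {λ n → 40 + 2 * stepCost n} round′)
      (+-IsO*2ⁿ {λ _ → 20} {emptyCost} (constant-IsO*2ⁿ 20) linear)
    rounds : IsO*2ⁿ (λ n → roundsCost n n)
    rounds = let c , d , le = closed in
      c , d , λ n → ≤-trans (≤-reflexive (roundsCost-closed n n)) (le n)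

-- Correctness of the tables

remove : ∀ {n} → Fin n → Fin n → Position n → Position n
remove u v S = S [ u ]≔ false [ v ]≔ false

extend-true : ∀ {n} p (r : Fin n → Maybe Colour) X Y S → extend p r X Y S ≡ true →
  X S ≡ true ⊎
  ∃[ v ] (lookup S v ≡ true × mayChoose p (r v) ≡ true × Y (S [ v ]≔ false) ≡ false)
extend-true p r X Y [] eq = inj₁ eq
extend-true p r X Y (false ∷ S) eq with extend-true p (r ∘ suc) _ _ S eq
... | inj₁ won               = inj₁ won
... | inj₂ (v , alive , m , lost) = inj₂ (suc v , alive , m , lost)
extend-true p r X Y (true ∷ S) eq
  with mayChoose p (r zero) in m₀ | extend-true p (r ∘ suc) _ _ S eq
... | _     | inj₂ (v , alive , m , lost) = inj₂ (suc v , alive , m , lost)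
... | false | inj₁ won = inj₁ won
-- The accumulator passed down already includes the move to `zero`, so a win found in it comes
-- either from X or from that move.
... | true  | inj₁ won with X (true ∷ S) | Y (false ∷ S) in lost
...   | true  | _     = inj₁ refl
...   | false | false = inj₂ (zero , refl , m₀ , lost)

extend-false : ∀ {n} p (r : Fin n → Maybe Colour) X Y S → extend p r X Y S ≡ false →
  X S ≡ false ×
  (∀ v → lookup S v ≡ true → mayChoose p (r v) ≡ true → Y (S [ v ]≔ false) ≡ true)
extend-false p r X Y [] eq = eq , λ ()
extend-false p r X Y (false ∷ S) eq with extend-false p (r ∘ suc) _ _ S eq
... | lost , won = lost , λ { (suc v) → won v }
extend-false p r X Y (true ∷ S) eq
  with mayChoose p (r zero) in m₀ | extend-false p (r ∘ suc) _ _ S eq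
... | false | lost , won = lost , λ
  { zero _ m → contradiction (trans (sym m₀) m) λ ()
  ; (suc v)  → won v }
... | true | lost , won with X (true ∷ S) | Y (false ∷ S) in won₀
...   | false | true = refl , λ { zero _ _ → won₀ ; (suc v) → won v }

step-true : ∀ {n} p (G : ColoredGraph n) Y S → step p G Y S ≡ true →
  ∃₂ λ u v → lookup S u ≡ true × lookup S v ≡ true ×
             mayChoose p (colour G u v) ≡ true × Y (remove u v S) ≡ false
step-true p G Y (false ∷ S) eq with step-true p (dropVertex G) _ S eq
... | u , v , option = suc u , suc v , option
step-true p G Y (true ∷ S) eq with extend-true p (colour G zero ∘ suc) _ _ S eq
... | inj₂ (v , alive , m , lost) = zero , suc v , refl , alive , m , lost
... | inj₁ won with step-true p (dropVertex G) _ S won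
...   | u , v , option = suc u , suc v , option

-- A reply must answer all ordered pairs, whereas `step` tries only u < v: symmetry covers the
-- reversed pairs and looplessness the diagonal.
step-false : ∀ {n} p (G : ColoredGraph n) Y S → step p G Y S ≡ false →
  ∀ u v → lookup S u ≡ true → lookup S v ≡ true →
  mayChoose p (colour G u v) ≡ true → Y (remove u v S) ≡ true
step-false p G Y (false ∷ S) eq (suc u) (suc v) = step-false p (dropVertex G) _ S eq u v
step-false p G Y (true ∷ S) eq u v with extend-false p (colour G zero ∘ suc) _ _ S eq
step-false p G Y (true ∷ S) eq zero zero | _ = λ _ _ m →
  contradiction (trans (sym (cong (mayChoose p) (loopless G zero))) m) λ ()
step-false p G Y (true ∷ S) eq zero (suc v) | _ , won = λ _ → won v
step-false p G Y (true ∷ S) eq (suc u) zero | _ , won = λ alive _ m →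
  won u alive (trans (cong (mayChoose p) (symmetric G zero (suc u))) m)
step-false p G Y (true ∷ S) eq (suc u) (suc v) | lost , _ =
  step-false p (dropVertex G) _ S lost u v

-- Strategies

mayChoose-sound : ∀ p e → mayChoose p e ≡ true → ∃[ c ] (e ≡ just c × MayChoose p c)
mayChoose-sound p (just gray)  _ = gray , refl , gray
mayChoose-sound B (just black) _ = black , refl , black
mayChoose-sound W (just white) _ = white , refl , white

mayChoose-complete : ∀ {p c} → MayChoose p c → mayChoose p (just c) ≡ true
mayChoose-complete gray  = refl
mayChoose-complete black = refl
mayChoose-complete white = refl

-- H is G[S] with the dead vertices kept as isolated ones. Comparing colours pointwise avoids
-- equating functions and the proof fields of graphs.
record Induced {n} (G : ColoredGraph n) (S : Position n) (H : ColoredGraph n) : Set where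
  constructor induced
  field
    colour-≡ : ∀ x y → colour H x y ≡ (if lookup S x ∧ lookup S y then colour G x y else nothing)

lookup-remove : ∀ {n} (u v x : Fin n) S →
  lookup (remove u v S) x ≡ (if isEndpoint u v x then false else lookup S x)
lookup-remove u v x S with x ≟ v
... | yes refl rewrite ∨-zeroʳ (does (x ≟ u)) = lookup∘update x (S [ u ]≔ false) false
... | no x≢v rewrite lookup∘update′ x≢v (S [ u ]≔ false) false with x ≟ u
...   | yes refl = lookup∘update x S false
...   | no x≢u   = lookup∘update′ x≢u S false

removeEdge-Induced : ∀ {n} {G H : ColoredGraph n} {S} u v → Induced G S H →
  Induced G (remove u v S) (removeEdge H u v)
removeEdge-Induced {G = G} {H} {S} u v (induced colour-≡) = induced removed
  where
  removed : ∀ x y → colour (removeEdge H u v) x y ≡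
    (if lookup (remove u v S) x ∧ lookup (remove u v S) y then colour G x y else nothing)
  removed x y
    rewrite lookup-remove u v x S | lookup-remove u v y S
    with isEndpoint u v x | isEndpoint u v y
  ... | true  | _     = refl
  ... | false | false = colour-≡ x y
  ... | false | true rewrite ∧-zeroʳ (lookup S x) = refl

Induced-full : ∀ {n} (G : ColoredGraph n) → Induced G (replicate n true) G
Induced-full {n} G = induced full
  where
  full : ∀ x y → colour G x y ≡
    (if lookup (replicate n true) x ∧ lookup (replicate n true) y then colour G x y else nothing)
  full x y rewrite lookup-replicate x true | lookup-replicate y true = refl

Induced-edge : ∀ {n} {G H : ColoredGraph n} {S u v c} → Induced G S H → colour H u v ≡ just c →
  lookup S u ≡ true × lookup S v ≡ true × colour G u v ≡ just c
Induced-edge {S = S} {u} {v} (induced colour-≡) eq with lookup S u | lookup S v | colour-≡ u v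
... | true  | true  | same = refl , refl , trans (sym same) eq
... | true  | false | same = contradiction (trans (sym same) eq) λ ()
... | false | _     | same = contradiction (trans (sym same) eq) λ ()

∣clear∣≤ : ∀ {n} (S : Position n) v → ∣ S [ v ]≔ false ∣ ≤ ∣ S ∣
∣clear∣≤ (false ∷ S) zero    = ≤-refl
∣clear∣≤ (true  ∷ S) zero    = n≤1+n _
∣clear∣≤ (false ∷ S) (suc v) = ∣clear∣≤ S v
∣clear∣≤ (true  ∷ S) (suc v) = s≤s (∣clear∣≤ S v)

∣clear∣< : ∀ {n} (S : Position n) v → lookup S v ≡ true → ∣ S [ v ]≔ false ∣ < ∣ S ∣
∣clear∣< (true  ∷ S) zero    _     = ≤-refl
∣clear∣< (false ∷ S) (suc v) alive = ∣clear∣< S v alive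
∣clear∣< (true  ∷ S) (suc v) alive = s≤s (∣clear∣< S v alive)

-- The death of u gives the strict decrease; clearing v cannot undo it.
∣remove∣< : ∀ {n} (S : Position n) u v → lookup S u ≡ true → ∣ remove u v S ∣ < ∣ S ∣
∣remove∣< S u v alive = ≤-<-trans (∣clear∣≤ (S [ u ]≔ false) v) (∣clear∣< S u alive)

opponent-involutive : ∀ p → opponent (opponent p) ≡ p
opponent-involutive B = refl
opponent-involutive W = refl

mutual
  -- The invariant ∣S∣ ≤ k ensures that the cut-off after k moves is never felt: each move uses up
  -- one round and at least one live vertex.
  wins-true : ∀ {n} (G : ColoredGraph n) k p S {H} → Induced G S H → ∣ S ∣ ≤ k →
    wins G k p S ≡ true → ToMove p H
  wins-true G (suc k) p S H-induced ∣S∣≤ won with step-true p G _ S won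
  ... | u , v , alive-u , alive-v , m , lost with mayChoose-sound p (colour G u v) m
  ...   | c , edge , mc =
    move u v
      (c , trans (Induced.colour-≡ H-induced u v)
             (trans (cong (if_then colour G u v else nothing) (cong₂ _∧_ alive-u alive-v)) edge) , mc)
      (wins-false G k p (remove u v S) (removeEdge-Induced u v H-induced)
        (≤-pred (≤-trans (∣remove∣< S u v alive-u) ∣S∣≤)) lost)

  wins-false : ∀ {n} (G : ColoredGraph n) k p S {H} → Induced G S H → ∣ S ∣ ≤ k →
    wins G k (opponent p) S ≡ false → ToReply p H
  -- With no round left no vertex is alive, so the opponent really is stuck and the value `false` at
  -- k = 0 is correct.
  wins-false G zero p S H-induced ∣S∣≤ _ = reply λ u v (c , edge , _) →
    let alive-u , _ = Induced-edge H-induced edge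
    in contradiction (≤-trans (∣remove∣< S u v alive-u) ∣S∣≤) λ ()
  wins-false G (suc k) p S H-induced ∣S∣≤ lost = reply λ u v (c , edge , mc) →
    let alive-u , alive-v , edge′ = Induced-edge H-induced edge in
    wins-true G k p (remove u v S) (removeEdge-Induced u v H-induced)
      (≤-pred (≤-trans (∣remove∣< S u v alive-u) ∣S∣≤))
      -- The table consulted belongs to the opponent of the opponent.
      (trans (cong (λ q → wins G k q (remove u v S)) (sym (opponent-involutive p)))
        (step-false (opponent p) G _ S lost u v alive-u alive-v
          (trans (cong (mayChoose (opponent p)) edge′) (mayChoose-complete mc))))

winner-strategy : ∀ {n} (G : ColoredGraph n) p →
  WinningStrategy (winner p (wins G n p (replicate n true))) p G
winner-strategy {n} G B with wins G n B (replicate n true) in eq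
... | true  = wins-true G n B _ (Induced-full G) (∣p∣≤n (replicate n true)) eq
... | false = wins-false G n W _ (Induced-full G) (∣p∣≤n (replicate n true)) eq
winner-strategy {n} G W with wins G n W (replicate n true) in eq
... | true  = wins-true G n W _ (Induced-full G) (∣p∣≤n (replicate n true)) eq
... | false = wins-false G n B _ (Induced-full G) (∣p∣≤n (replicate n true)) eq

theorem1 :
    Σ[ P ∈ Program ] Σ[ c ∈ ℕ ] Σ[ d ∈ ℕ ]
      (∀ (n : ℕ) (G : ColoredGraph n) (active : Player) →
        Σ[ winner ∈ Player ] Σ[ t ∈ ℕ ]
          (WinningStrategy winner active G
          × (P on encodeInput G active returns encodePlayer winner in-time t)
          × t ≤ c * size (encodeInput G active) ^ d * 2 ^ n))
theorem1 with solverCost-IsO*2ⁿ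
... | c , d , cost≤ = solver , c , d , λ n G active →
  case solver-runs G active of λ where
    (runs {t} evaluation (within t≤)) →
      winner active (wins G n active (replicate n true)) , t ,
      winner-strategy G active , evaluation ,
      (begin
        t                                             ≤⟨ t≤ ⟩
        solverCost n                                  ≤⟨ cost≤ n ⟩
        -- The encoding spends at least one node on each row and one more at the root, so n + 1 is
        -- at most the input size.
        c * suc n ^ d * 2 ^ n                         ≤⟨ *-monoˡ-≤ (2 ^ n) (*-monoʳ-≤ c
                                                           (^-monoˡ-≤ d (suc-n≤ G active))) ⟩
        c * size (encodeInput G active) ^ d * 2 ^ n   ∎)
  where
  open ≤-Reasoning
  suc-n≤ : ∀ {n} (G : ColoredGraph n) p → suc n ≤ size (encodeInput G p)
  suc-n≤ G p = s≤s (≤-trans (n≤size-encodeList _) (m≤n+m _ (size (encodePlayer p))))
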